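{- Let $n \ge m > 1$ be integers and let $A$ be an $n\times n$ matrix with all entries in $\{+1,-1\}$. Let $E(\det(M)^2)$ denote the mean value of $\det(M)^2$ taken over all $m\times m$ submatrices $M$ of $A$. Then $$E(\det(M)^2) \le n^m\Big/\binom{n}{m}.$$ Moreover, equality holds if and only if $A$ is a Hadamard matrix.
   Context: An $m\times m$ submatrix of $A$ is obtained by choosing $m$ of the rows and $m$ of the columns of $A$ (not necessarily consecutive). Submatrices are indexed by the choice of rows and columns, so there are exactly $\binom{n}{m}^2$ of them, and the mean is the uniform average over these $\binom{n}{m}^2$ choices. A Hadamard matrix of order $n$ is an $n\times n$ matrix $H$ with entries in $\{+1,-1\}$ satisfying $HH^T = nI$. -}

module Defs where

open import Data.Bool.Base using (if_then_else_)
open import Data.Empty using (⊥)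
open import Data.Fin.Base as Fin using (Fin; zero; suc; toℕ; punchIn)
import Data.Fin.Properties as Fin
open import Data.Integer.Base as ℤ using (ℤ; 0ℤ; 1ℤ; -1ℤ; +_)
import Data.Integer.Properties as ℤ
open import Data.List.Base as List using (List; []; _∷_; _++_; foldr; length; cartesianProductWith)
open import Data.List.Properties using (length-++; length-map)
open import Data.List.Membership.Propositional using (_∈_)
open import Data.List.Membership.Propositional.Properties using (∈-map⁺; ∈-map⁻; ∈-++⁺ˡ; ∈-++⁺ʳ; ∈-++⁻)
open import Data.List.Relation.Unary.All using ([])
open import Data.List.Relation.Unary.AllPairs using ([]; _∷_)
open import Data.List.Relation.Unary.Any using (here)
open import Data.List.Relation.Unary.Unique.Propositional using (Unique)
open import Data.List.Relation.Unary.Unique.Propositional.Properties using (map⁺; ++⁺)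
open import Data.Nat.Base as ℕ using (ℕ; zero; suc; NonZero; z≤n; s≤s; s≤s⁻¹)
open import Data.Nat.Combinatorics using (_C_; nCk+nC[k+1]≡[n+1]C[k+1]; k>n⇒nCk≡0)
import Data.Nat.Properties as ℕ
open import Data.Product.Base using (_×_; _,_)
open import Data.Rational.Base as ℚ using (ℚ)
open import Data.Sum.Base using (_⊎_; inj₁; inj₂)
open import Data.Vec.Base as Vec using (Vec; []; _∷_)
open import Data.Vec.Functional using (Vector)
import Data.Vec.Properties as Vec
open import Data.Vec.Relation.Unary.All as VecAll using ([]; _∷_)
import Data.Vec.Relation.Unary.All.Properties as VecAll
open import Data.Vec.Relation.Unary.AllPairs using (AllPairs; []; _∷_)
open import Function.Bundles using (_⇔_; mk⇔)
open import Relation.Binary.PropositionalEquality using (_≡_; refl; sym; trans; cong; cong₂; subst)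
open import Relation.Nullary.Decidable using (⌊_⌋)

open import Algebra.Properties.Semiring.Sum ℤ.+-*-semiring using (sum)

SquareMatrix : ℕ → Set
SquareMatrix n = Vector (Vector ℤ n) n

IsSignMatrix : ∀ {n} → SquareMatrix n → Set
IsSignMatrix A = ∀ i j → A i j ≡ 1ℤ ⊎ A i j ≡ -1ℤ

_*ᴹ_ : ∀ {n} → SquareMatrix n → SquareMatrix n → SquareMatrix n
(A *ᴹ B) i k = sum (λ j → A i j ℤ.* B j k)

_ᵀ : ∀ {n} → SquareMatrix n → SquareMatrix n
(A ᵀ) i j = A j i

identity : ∀ {n} → SquareMatrix n
identity i j = if ⌊ i Fin.≟ j ⌋ then 1ℤ else 0ℤ

IsHadamard : ∀ {n} → SquareMatrix n → Set
IsHadamard {n} H = IsSignMatrix H × (∀ i j → (H *ᴹ (H ᵀ)) i j ≡ + n ℤ.* identity i j)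

-- Laplace expansion along the first row.
det : ∀ {n} → SquareMatrix n → ℤ
det {zero}  A = 1ℤ
det {suc n} A = sum λ j →
  (-1ℤ ℤ.^ toℕ j) ℤ.* A zero j ℤ.* det (λ i k → A (suc i) (punchIn j k))

-- The m-element subsets of Fin n, each represented by its strictly
-- increasing vector of elements and listed exactly once: see
-- ∈-combinations, combinations-unique and length-combinations.
combinations : ∀ n m → List (Vec (Fin n) m)
combinations n       zero    = [] ∷ []
combinations zero    (suc m) = []
combinations (suc n) (suc m) =
  List.map (λ v → zero ∷ Vec.map Fin.suc v) (combinations n m) ++
  List.map (Vec.map Fin.suc) (combinations n (suc m))

submatrix : ∀ {n m} → SquareMatrix n → Vec (Fin n) m → Vec (Fin n) m → SquareMatrix m
submatrix A rows cols i j = A (Vec.lookup rows i) (Vec.lookup cols j)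

-- Indexed by the choices of rows and columns, so that submatrices equal
-- as matrices are still counted separately.
submatrices : ∀ {n} m → SquareMatrix n → List (SquareMatrix m)
submatrices {n} m A =
  cartesianProductWith (submatrix A) (combinations n m) (combinations n m)

mean : (xs : List ℤ) .{{_ : NonZero (length xs)}} → ℚ
mean xs = foldr ℤ._+_ 0ℤ xs ℚ./ length xs

Increasing : ∀ {n m} → Vec (Fin n) m → Set
Increasing = AllPairs Fin._<_

private
  map-suc⁺ : ∀ {n m} {v : Vec (Fin n) m} → Increasing v → Increasing (Vec.map Fin.suc v)
  map-suc⁺ []       = []
  map-suc⁺ (p ∷ ps) = VecAll.map⁺ (VecAll.map s≤s p) ∷ map-suc⁺ ps

  zero<map-suc : ∀ {n m} (v : Vec (Fin n) m) → VecAll.All (zero {n} Fin.<_) (Vec.map Fin.suc v)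
  zero<map-suc []      = []
  zero<map-suc (x ∷ v) = s≤s z≤n ∷ zero<map-suc v

  map-suc⁻ : ∀ {n m} {v : Vec (Fin n) m} → Increasing (Vec.map Fin.suc v) → Increasing v
  map-suc⁻ {v = []}    []       = []
  map-suc⁻ {v = _ ∷ _} (p ∷ ps) = VecAll.map s≤s⁻¹ (VecAll.map⁻ p) ∷ map-suc⁻ ps

  map-suc-injective : ∀ {n m} {v w : Vec (Fin n) m} → Vec.map Fin.suc v ≡ Vec.map Fin.suc w → v ≡ w
  map-suc-injective {v = []}    {[]}    _  = refl
  map-suc-injective {v = _ ∷ _} {_ ∷ _} eq =
    cong₂ _∷_ (Fin.suc-injective (Vec.∷-injectiveˡ eq)) (map-suc-injective (Vec.∷-injectiveʳ eq))

  data MapSuc {n m} : Vec (Fin (suc n)) m → Set where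
    mapSuc : (v : Vec (Fin n) m) → MapSuc (Vec.map Fin.suc v)

  unmap-suc : ∀ {n m} {x : Fin (suc n)} {v : Vec (Fin (suc n)) m} →
              VecAll.All (x Fin.<_) v → MapSuc v
  unmap-suc []                       = mapSuc []
  unmap-suc {v = zero ∷ _}  (() ∷ _)
  unmap-suc {v = suc y ∷ _} (_ ∷ ps) with unmap-suc ps
  ... | mapSuc v = mapSuc (y ∷ v)

∈-combinations⁻ : ∀ {n m} {v : Vec (Fin n) m} → v ∈ combinations n m → Increasing v
∈-combinations⁻ {n}     {zero}  {[]} _ = []
∈-combinations⁻ {suc n} {suc m} v∈ with ∈-++⁻ (List.map _ (combinations n m)) v∈
... | inj₁ v∈ˡ with ∈-map⁻ _ v∈ˡ
...   | w , w∈ , refl = zero<map-suc w ∷ map-suc⁺ (∈-combinations⁻ w∈)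
∈-combinations⁻ {suc n} {suc m} v∈ | inj₂ v∈ʳ with ∈-map⁻ _ v∈ʳ
...   | w , w∈ , refl = map-suc⁺ (∈-combinations⁻ w∈)

∈-combinations⁺ : ∀ {n m} {v : Vec (Fin n) m} → Increasing v → v ∈ combinations n m
∈-combinations⁺ {n}     {zero}  {[]}       _        = here refl
∈-combinations⁺ {suc n} {suc m} {zero ∷ v} (p ∷ ps) with unmap-suc p
... | mapSuc w = ∈-++⁺ˡ (∈-map⁺ _ (∈-combinations⁺ (map-suc⁻ ps)))
∈-combinations⁺ {suc n} {suc m} {suc x ∷ v} (p ∷ ps) with unmap-suc p
... | mapSuc w = ∈-++⁺ʳ (List.map _ (combinations n m))
                   (∈-map⁺ (Vec.map Fin.suc) (∈-combinations⁺ (map-suc⁻ {v = x ∷ w} (p ∷ ps))))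

∈-combinations : ∀ {n m} {v : Vec (Fin n) m} → v ∈ combinations n m ⇔ Increasing v
∈-combinations = mk⇔ ∈-combinations⁻ ∈-combinations⁺

combinations-unique : ∀ n m → Unique (combinations n m)
combinations-unique n       zero    = [] ∷ []
combinations-unique zero    (suc m) = []
combinations-unique (suc n) (suc m) = ++⁺
  (map⁺ (λ eq → map-suc-injective (Vec.∷-injectiveʳ eq)) (combinations-unique n m))
  (map⁺ (map-suc-injective) (combinations-unique n (suc m)))
  (λ (l , r) → disjoint l r)
  where
  disjoint : ∀ {v : Vec (Fin (suc n)) (suc m)} → v ∈ List.map (λ w → zero ∷ Vec.map Fin.suc w) (combinations n m) →
             v ∈ List.map (Vec.map Fin.suc) (combinations n (suc m)) → ⊥
  disjoint l r with ∈-map⁻ (λ w → zero ∷ Vec.map Fin.suc w) l | ∈-map⁻ (Vec.map Fin.suc) r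
  ... | _ , _ , refl | _ ∷ _ , _ , ()

length-combinations : ∀ n m → length (combinations n m) ≡ n C m
length-combinations n       zero    = refl
length-combinations zero    (suc m) = sym (k>n⇒nCk≡0 (s≤s (z≤n {m})))
length-combinations (suc n) (suc m) =
  trans (length-++ (List.map _ (combinations n m)))
  (trans (cong₂ ℕ._+_
    (trans (length-map _ (combinations n m)) (length-combinations n m))
    (trans (length-map _ (combinations n (suc m))) (length-combinations n (suc m))))
  (nCk+nC[k+1]≡[n+1]C[k+1] n m))

length-cartesianProductWith : ∀ {A B C : Set} (f : A → B → C) xs ys →
  length (cartesianProductWith f xs ys) ≡ length xs ℕ.* length ys
length-cartesianProductWith f []       ys = refl
length-cartesianProductWith f (x ∷ xs) ys =
  trans (length-++ (List.map (f x) ys))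
    (cong₂ ℕ._+_ (length-map (f x) ys) (length-cartesianProductWith f xs ys))

length-submatrices : ∀ {n} m (A : SquareMatrix n) →
                     length (submatrices m A) ≡ (n C m) ℕ.* (n C m)
length-submatrices {n} m A =
  trans (length-cartesianProductWith (submatrix A) (combinations n m) (combinations n m))
    (cong₂ ℕ._*_ (length-combinations n m) (length-combinations n m))

nCm-nonZero : ∀ {n m} → m ℕ.≤ n → NonZero (n C m)
nCm-nonZero {m = zero}          _         = _
nCm-nonZero {suc n} {m = suc m} (s≤s m≤n) =
  ℕ.>-nonZero (subst (0 ℕ.<_) (nCk+nC[k+1]≡[n+1]C[k+1] n m)
    (ℕ.<-≤-trans (ℕ.>-nonZero⁻¹ (n C m) {{nCm-nonZero m≤n}}) (ℕ.m≤m+n (n C m) _)))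

det² : ∀ {n} → SquareMatrix n → ℤ
det² M = det M ℤ.^ 2

length-det²-nonZero : ∀ {n m} → m ℕ.≤ n → (A : SquareMatrix n) →
                      NonZero (length (List.map det² (submatrices m A)))
length-det²-nonZero {n} {m} m≤n A =
  subst NonZero (sym (trans (length-map det² (submatrices m A)) (length-submatrices m A)))
    (ℕ.m*n≢0 (n C m) (n C m) {{nCm-nonZero m≤n}} {{nCm-nonZero m≤n}})

meanDet² : ∀ {n m} → m ℕ.≤ n → SquareMatrix n → ℚ
meanDet² {n} {m} m≤n A =
  mean (List.map det² (submatrices m A)) {{length-det²-nonZero m≤n A}}

{-# OPTIONS --safe #-}
module Submission where

-- For v ∈ ℤⁿ, wedging v ∧ and contracting v ⌟ on the exterior algebra of ℤⁿ are
-- adjoint and satisfy u ⌟ v ∧ x + v ∧ u ⌟ x = ⟨u, v⟩ x, so |v ∧ x|² + |v ⌟ x|² = |v|² |x|².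
-- Hence |v₁ ∧ … ∧ vₘ|² ≤ |v₁|² ⋯ |vₘ|², and equality forces each vᵢ to contract
-- vᵢ₊₁ ∧ … ∧ vₘ to zero, that is, the vᵢ to be orthogonal (when they are nonzero).
-- By Laplace expansion the coordinates of v₁ ∧ … ∧ vₘ are the maximal minors of the
-- matrix with rows vᵢ, so the sum of det² over the submatrices with given rows is at
-- most nᵐ; since m ≥ 2, any two rows of A occur together in such a choice.

open import Defs
open import Data.Fin.Base as Fin using (Fin; zero; suc; toℕ; punchIn)
import Data.Fin.Properties as Fin
open import Data.Fin.Subset as Subset using (Subset; inside; outside; ⁅_⁆; _∪_; ∣_∣)
open import Data.Fin.Subset.Properties using (∣p∣≤n; x∈⁅x⁆; ∣⁅x⁆∣≡1; x∈p∪q⁺)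
open import Data.Integer.Base as ℤ using (ℤ; +_; 0ℤ; 1ℤ; -1ℤ; _+_; _*_)
open import Data.Integer.Properties as ℤ using (*-comm; *-zeroˡ; *-zeroʳ; +-*-semiring)
open import Data.Integer.Tactic.RingSolver using (solve-∀; solve)
open import Data.List.Base as List using (List; []; _∷_; _++_; foldr; length; cartesianProductWith)
open import Data.List.Membership.Propositional using (_∈_)
open import Data.List.Membership.Propositional.Properties using (∈-map⁺; ∈-++⁺ˡ; ∈-++⁺ʳ)
import Data.List.Properties as List
open import Data.List.Relation.Unary.Any using (here; there)
open import Data.Nat.Base as ℕ using (ℕ; zero; suc; NonZero; _≤_; _<_; _^_; z≤n; s≤s)
open import Data.Nat.Combinatorics using (_C_)
import Data.Nat.Properties as ℕ
open import Data.Product.Base using (∃; _×_; _,_; proj₂)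
open import Data.Rational.Base as ℚ using (_/_)
import Data.Rational.Properties as ℚ
import Data.Rational.Unnormalised.Base as ℚᵘ
import Data.Rational.Unnormalised.Properties as ℚᵘ
open import Data.Sum.Base using (_⊎_; [_,_]′; inj₁; inj₂)
open import Data.Vec.Base as Vec using (Vec; lookup; removeAt; here; there)
open import Data.Vec.Functional using (Vector; head; tail)
import Data.Vec.Properties as Vec
import Data.Vec.Relation.Unary.All.Properties as VecAll
open import Function.Base using (_∘_; id)
open import Function.Bundles using (_⇔_; mk⇔; Equivalence)
open import Relation.Binary.Definitions using (tri<; tri≈; tri>)
open import Relation.Binary.PropositionalEquality
  using (_≡_; _≢_; refl; sym; trans; cong; cong₂; subst; subst₂; module ≡-Reasoning)
open import Relation.Nullary.Decidable using (yes; no)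
open import Relation.Nullary.Negation using (contradiction)

open import Algebra.Properties.AbelianGroup ℤ.+-0-abelianGroup using (∙-cancelˡ)
open import Algebra.Properties.Semiring.Sum +-*-semiring using (sum; sum-cong-≗; *-distribˡ-sum)

private
  variable
    n m : ℕ

-- The exterior algebra of ℤⁿ: wedge, contraction, inner product

infixr 7 _∧_ _⌟_
infix 6 _·_⊕_·_

-- The exterior algebra of ℤⁿ⁺¹ is e₀ ∧ Λ n ⊕ Λ n: node a b stands for e₀ ∧ a + b.
data Λ : ℕ → Set where
  leaf : ℤ → Λ zero
  node : (a b : Λ n) → Λ (suc n)

-- Sum and scalar multiple are one operation, so that a linear identity reduces coordinatewise to a
-- ring identity at the leaves. A lone multiple p x is written with a second summand of coefficient
-- `0ℤ`.
_·_⊕_·_ : ℤ → Λ n → ℤ → Λ n → Λ n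
p · leaf x ⊕ q · leaf y     = leaf (p * x + q * y)
p · node a b ⊕ q · node c d = node (p · a ⊕ q · c) (p · b ⊕ q · d)

0Λ : Λ n
0Λ {zero}  = leaf 0ℤ
0Λ {suc n} = node 0Λ 0Λ

1Λ : Λ n
1Λ {zero}  = leaf 1ℤ
1Λ {suc n} = node 0Λ 1Λ

-- For v = c e₀ + w this is v ∧ (e₀ ∧ a + b) = e₀ ∧ (c b - w ∧ a) + w ∧ b; the sign comes from
-- moving w past e₀.
_∧_ : Vector ℤ n → Λ n → Λ n
v ∧ leaf x   = leaf 0ℤ
v ∧ node a b = node (head v · b ⊕ -1ℤ · tail v ∧ a) (tail v ∧ b)

-- The antiderivation with v ⌟ u = ⟨v, u⟩ on vectors: for v = c e₀ + w, contracting e₀ ∧ a + b gives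
-- - e₀ ∧ (w ⌟ a) + (c a + w ⌟ b).
_⌟_ : Vector ℤ n → Λ n → Λ n
v ⌟ leaf x   = leaf 0ℤ
v ⌟ node a b = node (-1ℤ · tail v ⌟ a ⊕ 0ℤ · tail v ⌟ a) (head v · a ⊕ 1ℤ · tail v ⌟ b)

-- The increasing products of basis vectors form an orthonormal basis.
⟪_,_⟫ : Λ n → Λ n → ℤ
⟪ leaf x , leaf y ⟫     = x * y
⟪ node a b , node c d ⟫ = ⟪ a , c ⟫ + ⟪ b , d ⟫

dot : Vector ℤ n → Vector ℤ n → ℤ
dot u v = sum λ k → u k * v k

-- Linearity of wedge and contraction

⊕-interchange : ∀ p q r s (w x y z : Λ n) →
  p · (r · w ⊕ s · x) ⊕ q · (r · y ⊕ s · z) ≡ r · (p · w ⊕ q · y) ⊕ s · (p · x ⊕ q · z)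
⊕-interchange p q r s (leaf w) (leaf x) (leaf y) (leaf z) =
  cong leaf (solve (p ∷ q ∷ r ∷ s ∷ w ∷ x ∷ y ∷ z ∷ []))
⊕-interchange p q r s (node w w′) (node x x′) (node y y′) (node z z′) =
  cong₂ node (⊕-interchange p q r s w x y z) (⊕-interchange p q r s w′ x′ y′ z′)

⊕-zero : ∀ p q → p · 0Λ {n} ⊕ q · 0Λ ≡ 0Λ
⊕-zero {zero}  p q = cong leaf (solve (p ∷ q ∷ []))
⊕-zero {suc n} p q = cong₂ node (⊕-zero p q) (⊕-zero p q)

⊕-null : ∀ (x y : Λ n) → 0ℤ · x ⊕ 0ℤ · y ≡ 0Λ
⊕-null (leaf x)   (leaf y)   = cong leaf (solve (x ∷ y ∷ []))
⊕-null (node a b) (node c d) = cong₂ node (⊕-null a c) (⊕-null b d)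

∧-zero : ∀ (v : Vector ℤ n) → v ∧ 0Λ ≡ 0Λ
∧-zero {zero}  v = refl
∧-zero {suc n} v rewrite ∧-zero (tail v) = cong (λ a → node a 0Λ) (⊕-zero (head v) -1ℤ)

⌟-zero : ∀ (v : Vector ℤ n) → v ⌟ 0Λ ≡ 0Λ
⌟-zero {zero}  v = refl
⌟-zero {suc n} v rewrite ⌟-zero (tail v) = cong₂ node (⊕-zero -1ℤ 0ℤ) (⊕-zero (head v) 1ℤ)

⌟-one : ∀ (v : Vector ℤ n) → v ⌟ 1Λ ≡ 0Λ
⌟-one {zero}  v = refl
⌟-one {suc n} v rewrite ⌟-zero (tail v) | ⌟-one (tail v) =
  cong₂ node (⊕-zero -1ℤ 0ℤ) (⊕-zero (head v) 1ℤ)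

∧-linear : ∀ v p q (x y : Λ n) → v ∧ (p · x ⊕ q · y) ≡ p · v ∧ x ⊕ q · v ∧ y
∧-linear v p q (leaf x)   (leaf y)   = cong leaf (solve (p ∷ q ∷ []))
∧-linear v p q (node a b) (node c d)
  rewrite ∧-linear (tail v) p q a c | ∧-linear (tail v) p q b d =
  cong (λ x → node x _) (⊕-interchange (head v) -1ℤ p q b d _ _)

⌟-linear : ∀ v p q (x y : Λ n) → v ⌟ (p · x ⊕ q · y) ≡ p · v ⌟ x ⊕ q · v ⌟ y
⌟-linear v p q (leaf x)   (leaf y)   = cong leaf (solve (p ∷ q ∷ []))
⌟-linear v p q (node a b) (node c d)
  rewrite ⌟-linear (tail v) p q a c | ⌟-linear (tail v) p q b d =
  cong₂ node (⊕-interchange -1ℤ 0ℤ p q _ _ _ _) (⊕-interchange (head v) 1ℤ p q a c _ _)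

-- Anticommutation relations

private
  ⊕-collect : ∀ p q (x : Λ n) → p · x ⊕ 1ℤ · (q · x ⊕ 0ℤ · x) ≡ (p + q) · x ⊕ 0ℤ · x
  ⊕-collect p q (leaf x)   = cong leaf (solve (p ∷ q ∷ x ∷ []))
  ⊕-collect p q (node a b) = cong₂ node (⊕-collect p q a) (⊕-collect p q b)

  -- The e₀-component of `⌟-∧` once linearity has been applied: `b` stands for `tail v ⌟ b`, while
  -- `x` and `y` stand for the two mixed products of the tails applied to `a`. The terms in `b`
  -- cancel.
  ⌟-∧-upper : ∀ c d (a b x y : Λ n) →
    1ℤ · (-1ℤ · (d · b ⊕ -1ℤ · x) ⊕ 0ℤ · (d · b ⊕ -1ℤ · x)) ⊕
    1ℤ · (d · (c · a ⊕ 1ℤ · b) ⊕ -1ℤ · (-1ℤ · y ⊕ 0ℤ · y)) ≡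
    (c * d) · a ⊕ 1ℤ · (1ℤ · x ⊕ 1ℤ · y)
  ⌟-∧-upper c d (leaf a) (leaf b) (leaf x) (leaf y) =
    cong leaf (solve (c ∷ d ∷ a ∷ b ∷ x ∷ y ∷ []))
  ⌟-∧-upper c d (node a a′) (node b b′) (node x x′) (node y y′) =
    cong₂ node (⌟-∧-upper c d a b x y) (⌟-∧-upper c d a′ b′ x′ y′)

  ⌟-∧-lower : ∀ c d (a b x y : Λ n) →
    1ℤ · (c · (d · b ⊕ -1ℤ · a) ⊕ 1ℤ · x) ⊕ 1ℤ · (c · a ⊕ 1ℤ · y) ≡
    (c * d) · b ⊕ 1ℤ · (1ℤ · x ⊕ 1ℤ · y)
  ⌟-∧-lower c d (leaf a) (leaf b) (leaf x) (leaf y) =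
    cong leaf (solve (c ∷ d ∷ a ∷ b ∷ x ∷ y ∷ []))
  ⌟-∧-lower c d (node a a′) (node b b′) (node x x′) (node y y′) =
    cong₂ node (⌟-∧-lower c d a b x y) (⌟-∧-lower c d a′ b′ x′ y′)

  ⌟-⌟-lower : ∀ c d (a b y : Λ n) →
    c · (-1ℤ · a ⊕ 0ℤ · a) ⊕ 1ℤ · (d · b ⊕ 1ℤ · (-1ℤ · y ⊕ 0ℤ · y)) ≡
    -1ℤ · (d · (-1ℤ · b ⊕ 0ℤ · b) ⊕ 1ℤ · (c · a ⊕ 1ℤ · y)) ⊕
    0ℤ · (d · (-1ℤ · b ⊕ 0ℤ · b) ⊕ 1ℤ · (c · a ⊕ 1ℤ · y))
  ⌟-⌟-lower c d (leaf a) (leaf b) (leaf y) =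
    cong leaf (solve (c ∷ d ∷ a ∷ b ∷ y ∷ []))
  ⌟-⌟-lower c d (node a a′) (node b b′) (node y y′) =
    cong₂ node (⌟-⌟-lower c d a b y) (⌟-⌟-lower c d a′ b′ y′)

-- Induction on the dimension: in both components the cross terms cancel, the tails contribute their
-- dot product by induction, and `⊕-collect` adds the product of the heads.
⌟-∧ : ∀ v u (x : Λ n) → 1ℤ · v ⌟ u ∧ x ⊕ 1ℤ · u ∧ v ⌟ x ≡ dot v u · x ⊕ 0ℤ · x
⌟-∧ v u (leaf x)   = cong leaf (solve (x ∷ []))
⌟-∧ v u (node a b)
  rewrite ⌟-linear (tail v) (head u) -1ℤ b (tail u ∧ a)
        | ∧-linear (tail u) -1ℤ 0ℤ (tail v ⌟ a) (tail v ⌟ a)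
        | ∧-linear (tail u) (head v) 1ℤ a (tail v ⌟ b)
        = cong₂ node
  (trans (⌟-∧-upper (head v) (head u) a (tail v ⌟ b) (tail v ⌟ tail u ∧ a) (tail u ∧ tail v ⌟ a))
  (trans (cong (_·_⊕_·_ _ a 1ℤ) (⌟-∧ (tail v) (tail u) a)) (⊕-collect _ _ a)))
  (trans (⌟-∧-lower (head v) (head u) (tail u ∧ a) b (tail v ⌟ tail u ∧ b) (tail u ∧ tail v ⌟ b))
  (trans (cong (_·_⊕_·_ _ b 1ℤ) (⌟-∧ (tail v) (tail u) b)) (⊕-collect _ _ b)))

⌟-⌟ : ∀ v u (x : Λ n) → v ⌟ u ⌟ x ≡ -1ℤ · u ⌟ v ⌟ x ⊕ 0ℤ · u ⌟ v ⌟ x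
⌟-⌟ v u (leaf x)   = refl
⌟-⌟ v u (node a b)
  rewrite ⌟-linear (tail v) -1ℤ 0ℤ (tail u ⌟ a) (tail u ⌟ a)
        | ⌟-linear (tail u) -1ℤ 0ℤ (tail v ⌟ a) (tail v ⌟ a)
        | ⌟-linear (tail v) (head u) 1ℤ a (tail u ⌟ b)
        | ⌟-linear (tail u) (head v) 1ℤ a (tail v ⌟ b)
        | ⌟-⌟ (tail v) (tail u) a
        | ⌟-⌟ (tail v) (tail u) b
        -- After the rewrites both sides have the same e₀-component; only the other one remains.
        = cong (node _)
  (⌟-⌟-lower (head v) (head u) (tail u ⌟ a) (tail v ⌟ a) (tail u ⌟ tail v ⌟ b))

-- Bilinearity of the inner product and adjointness

⟪⟫-comm : ∀ (x y : Λ n) → ⟪ x , y ⟫ ≡ ⟪ y , x ⟫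
⟪⟫-comm (leaf x)   (leaf y)   = *-comm x y
⟪⟫-comm (node a b) (node c d) = cong₂ _+_ (⟪⟫-comm a c) (⟪⟫-comm b d)

⟪⟫-zeroˡ : ∀ (x : Λ n) → ⟪ 0Λ , x ⟫ ≡ 0ℤ
⟪⟫-zeroˡ (leaf x)   = *-zeroˡ x
⟪⟫-zeroˡ (node a b) = cong₂ _+_ (⟪⟫-zeroˡ a) (⟪⟫-zeroˡ b)

⟪⟫-zeroʳ : ∀ (x : Λ n) → ⟪ x , 0Λ ⟫ ≡ 0ℤ
⟪⟫-zeroʳ x = trans (⟪⟫-comm x 0Λ) (⟪⟫-zeroˡ x)

⟪⟫-linearʳ : ∀ p q (z x y : Λ n) → ⟪ z , p · x ⊕ q · y ⟫ ≡ p * ⟪ z , x ⟫ + q * ⟪ z , y ⟫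
⟪⟫-linearʳ p q (leaf z)   (leaf x)   (leaf y)   = distrib p q x y z
  where
  distrib : ∀ p q x y z → z * (p * x + q * y) ≡ p * (z * x) + q * (z * y)
  distrib = solve-∀
⟪⟫-linearʳ p q (node e f) (node a b) (node c d)
  rewrite ⟪⟫-linearʳ p q e a c | ⟪⟫-linearʳ p q f b d =
  regroup p q ⟪ e , a ⟫ ⟪ e , c ⟫ ⟪ f , b ⟫ ⟪ f , d ⟫
  where
  regroup : ∀ p q a b c d → p * a + q * b + (p * c + q * d) ≡ p * (a + c) + q * (b + d)
  regroup = solve-∀

⟪⟫-linearˡ : ∀ p q (x y z : Λ n) → ⟪ p · x ⊕ q · y , z ⟫ ≡ p * ⟪ x , z ⟫ + q * ⟪ y , z ⟫
⟪⟫-linearˡ p q x y z = begin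
  ⟪ p · x ⊕ q · y , z ⟫         ≡⟨ ⟪⟫-comm _ z ⟩
  ⟪ z , p · x ⊕ q · y ⟫         ≡⟨ ⟪⟫-linearʳ p q z x y ⟩
  p * ⟪ z , x ⟫ + q * ⟪ z , y ⟫ ≡⟨ cong₂ (λ a b → p * a + q * b) (⟪⟫-comm z x) (⟪⟫-comm z y) ⟩
  p * ⟪ x , z ⟫ + q * ⟪ y , z ⟫ ∎
  where open ≡-Reasoning

-- Both sides couple `b` with `c` through `head v`, and both carry the sign -1 on the tail term
-- between `a` and `c`; the tails are adjoint by induction.
∧-⌟-adjoint : ∀ v (x y : Λ n) → ⟪ v ∧ x , y ⟫ ≡ ⟪ x , v ⌟ y ⟫
∧-⌟-adjoint v (leaf x)   (leaf y)   = trans (*-zeroˡ y) (sym (*-zeroʳ x))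
∧-⌟-adjoint v (node a b) (node c d)
  rewrite ⟪⟫-linearˡ (head v) -1ℤ b (tail v ∧ a) c
        | ⟪⟫-linearʳ -1ℤ 0ℤ a (tail v ⌟ c) (tail v ⌟ c)
        | ⟪⟫-linearʳ (head v) 1ℤ b c (tail v ⌟ d)
        | ∧-⌟-adjoint (tail v) a c
        | ∧-⌟-adjoint (tail v) b d
        = regroup (head v) ⟪ b , c ⟫ ⟪ a , tail v ⌟ c ⟫ ⟪ b , tail v ⌟ d ⟫
  where
  regroup : ∀ c x y z → c * x + -1ℤ * y + z ≡ -1ℤ * y + 0ℤ * y + (c * x + 1ℤ * z)
  regroup = solve-∀

∥_∥² : Λ n → ℤ
∥ x ∥² = ⟪ x , x ⟫


-- Positivity of the norm

0≤i*i : ∀ i → 0ℤ ℤ.≤ i * i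
0≤i*i (+ zero)     = ℤ.≤-refl
0≤i*i (+ suc n)    = ℤ.+≤+ ℕ.z≤n
0≤i*i ℤ.-[1+ n ]   = ℤ.+≤+ ℕ.z≤n

i≤i+j : ∀ i {j} → 0ℤ ℤ.≤ j → i ℤ.≤ i + j
i≤i+j i {j} 0≤j = ℤ.i≤i+j i j {{ℤ.nonNegative 0≤j}}

i+j≡0⇒i≡0 : ∀ {i j} → 0ℤ ℤ.≤ i → 0ℤ ℤ.≤ j → i + j ≡ 0ℤ → i ≡ 0ℤ
i+j≡0⇒i≡0 {i} 0≤i 0≤j i+j≡0 = ℤ.≤-antisym (subst (i ℤ.≤_) i+j≡0 (i≤i+j i 0≤j)) 0≤i

i+j≡i⇒j≡0 : ∀ i {j} → i + j ≡ i → j ≡ 0ℤ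
i+j≡i⇒j≡0 i i+j≡i = ∙-cancelˡ i _ _ (trans i+j≡i (sym (ℤ.+-identityʳ i)))

0≤∥x∥² : ∀ (x : Λ n) → 0ℤ ℤ.≤ ∥ x ∥²
0≤∥x∥² (leaf x)   = 0≤i*i x
0≤∥x∥² (node a b) = ℤ.+-mono-≤ (0≤∥x∥² a) (0≤∥x∥² b)

∥x∥²≡0⇒x≡0 : ∀ (x : Λ n) → ∥ x ∥² ≡ 0ℤ → x ≡ 0Λ
∥x∥²≡0⇒x≡0 (leaf x)   eq = cong leaf ([ id , id ]′ (ℤ.i*j≡0⇒i≡0∨j≡0 x eq))
∥x∥²≡0⇒x≡0 (node a b) eq = cong₂ node
  (∥x∥²≡0⇒x≡0 a (i+j≡0⇒i≡0 (0≤∥x∥² a) (0≤∥x∥² b) eq))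
  (∥x∥²≡0⇒x≡0 b (i+j≡0⇒i≡0 (0≤∥x∥² b) (0≤∥x∥² a) (trans (ℤ.+-comm ∥ b ∥² ∥ a ∥²) eq)))

∥1∥² : ∥ 1Λ {n} ∥² ≡ 1ℤ
∥1∥² {zero}  = refl
∥1∥² {suc n} = cong₂ _+_ (⟪⟫-zeroˡ {n} 0Λ) (∥1∥² {n})

-- Adjointness turns both squared norms into inner products with `x`, whose sum is given by `⌟-∧` at
-- u = v.
pythagoras : ∀ v (x : Λ n) → ∥ v ∧ x ∥² + ∥ v ⌟ x ∥² ≡ dot v v * ∥ x ∥²
pythagoras v x = begin
  ∥ v ∧ x ∥² + ∥ v ⌟ x ∥²
    ≡⟨ cong₂ _+_ (∧-⌟-adjoint v x (v ∧ x))
                 (trans (sym (∧-⌟-adjoint v (v ⌟ x) x)) (⟪⟫-comm (v ∧ v ⌟ x) x)) ⟩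
  ⟪ x , v ⌟ v ∧ x ⟫ + ⟪ x , v ∧ v ⌟ x ⟫
    ≡⟨ cong₂ _+_ (ℤ.*-identityˡ ⟪ x , v ⌟ v ∧ x ⟫) (ℤ.*-identityˡ ⟪ x , v ∧ v ⌟ x ⟫) ⟨
  1ℤ * ⟪ x , v ⌟ v ∧ x ⟫ + 1ℤ * ⟪ x , v ∧ v ⌟ x ⟫
    ≡⟨ ⟪⟫-linearʳ 1ℤ 1ℤ x (v ⌟ v ∧ x) (v ∧ v ⌟ x) ⟨
  ⟪ x , 1ℤ · v ⌟ v ∧ x ⊕ 1ℤ · v ∧ v ⌟ x ⟫
    ≡⟨ cong ⟪ x ,_⟫ (⌟-∧ v v x) ⟩
  ⟪ x , dot v v · x ⊕ 0ℤ · x ⟫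
    ≡⟨ ⟪⟫-linearʳ (dot v v) 0ℤ x x x ⟩
  dot v v * ∥ x ∥² + 0ℤ * ∥ x ∥²
    ≡⟨ drop-zero (dot v v) ∥ x ∥² ⟩
  dot v v * ∥ x ∥² ∎
  where
  open ≡-Reasoning
  drop-zero : ∀ k a → k * a + 0ℤ * a ≡ k * a
  drop-zero = solve-∀

-- Wedge products of families of vectors

⊕-identityˡ : ∀ (x : Λ n) → 1ℤ · 0Λ ⊕ 1ℤ · x ≡ x
⊕-identityˡ (leaf x)   = cong leaf (solve (x ∷ []))
⊕-identityˡ (node a b) = cong₂ node (⊕-identityˡ a) (⊕-identityˡ b)

⊕-identityʳ : ∀ (x : Λ n) → 1ℤ · x ⊕ 1ℤ · 0Λ ≡ x
⊕-identityʳ (leaf x)   = cong leaf (solve (x ∷ []))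
⊕-identityʳ (node a b) = cong₂ node (⊕-identityʳ a) (⊕-identityʳ b)

⋀ : Vector (Vector ℤ n) m → Λ n
⋀ {m = zero}  V = 1Λ
⋀ {m = suc m} V = head V ∧ ⋀ (tail V)

PairwiseOrthogonal : Vector (Vector ℤ n) m → Set
PairwiseOrthogonal V = ∀ {i j} → i Fin.< j → dot (V i) (V j) ≡ 0ℤ

-- By `⌟-∧`, moving the contraction past a factor leaves a multiple by a dot product, which vanishes
-- here; after the last factor it meets `1Λ`, which it kills.
orthogonal⇒⌟≡0 : ∀ v (V : Vector (Vector ℤ n) m) → (∀ j → dot v (V j) ≡ 0ℤ) → v ⌟ ⋀ V ≡ 0Λ
orthogonal⇒⌟≡0 {m = zero}  v V v⊥V = ⌟-one v
orthogonal⇒⌟≡0 {m = suc m} v V v⊥V = begin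
  v ⌟ u ∧ x
    ≡⟨ ⊕-identityʳ _ ⟨
  1ℤ · v ⌟ u ∧ x ⊕ 1ℤ · 0Λ
    ≡⟨ cong (_·_⊕_·_ 1ℤ _ 1ℤ) (trans (cong (u ∧_) (orthogonal⇒⌟≡0 v (tail V) (v⊥V ∘ suc))) (∧-zero u)) ⟨
  1ℤ · v ⌟ u ∧ x ⊕ 1ℤ · u ∧ v ⌟ x
    ≡⟨ ⌟-∧ v u x ⟩
  dot v u · x ⊕ 0ℤ · x
    ≡⟨ cong (λ k → k · x ⊕ 0ℤ · x) (v⊥V zero) ⟩
  0ℤ · x ⊕ 0ℤ · x
    ≡⟨ ⊕-null x x ⟩
  0Λ ∎
  where
  open ≡-Reasoning
  u = head V
  x = ⋀ (tail V)

-- Hadamard's inequality for vectors of equal norm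

module Hadamard (d : ℕ) where

  IsEquinormal : Vector (Vector ℤ n) m → Set
  IsEquinormal V = ∀ i → dot (V i) (V i) ≡ + d

  private
    head-pythagoras : ∀ (V : Vector (Vector ℤ n) (suc m)) → IsEquinormal V →
      ∥ ⋀ V ∥² + ∥ head V ⌟ ⋀ (tail V) ∥² ≡ + d * ∥ ⋀ (tail V) ∥²
    head-pythagoras V norms =
      trans (pythagoras (head V) (⋀ (tail V))) (cong (_* ∥ ⋀ (tail V) ∥²) (norms zero))

  -- The contraction term in `head-pythagoras` is nonnegative, so dropping it shows that each vector
  -- multiplies the squared norm by at most `d`.
  ∥⋀∥²≤ : ∀ (V : Vector (Vector ℤ n) m) → IsEquinormal V → ∥ ⋀ V ∥² ℤ.≤ + (d ℕ.^ m)
  ∥⋀∥²≤ {n} {zero}  V norms = ℤ.≤-reflexive (∥1∥² {n})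
  ∥⋀∥²≤ {m = suc m} V norms = begin
    ∥ ⋀ V ∥²                                  ≤⟨ i≤i+j _ (0≤∥x∥² (head V ⌟ ⋀ (tail V))) ⟩
    ∥ ⋀ V ∥² + ∥ head V ⌟ ⋀ (tail V) ∥²       ≡⟨ head-pythagoras V norms ⟩
    + d * ∥ ⋀ (tail V) ∥²                     ≤⟨ ℤ.*-monoˡ-≤-nonNeg (+ d) (∥⋀∥²≤ (tail V) (norms ∘ suc)) ⟩
    + d * + (d ℕ.^ m)                         ≡⟨ ℤ.pos-* d (d ℕ.^ m) ⟨
    + (d ℕ.^ suc m)                           ∎
    where open ℤ.≤-Reasoning

  orthogonal⇒∥⋀∥²≡ : ∀ (V : Vector (Vector ℤ n) m) → IsEquinormal V → PairwiseOrthogonal V →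
    ∥ ⋀ V ∥² ≡ + (d ℕ.^ m)
  orthogonal⇒∥⋀∥²≡ {n} {zero}  V norms V⊥ = ∥1∥² {n}
  orthogonal⇒∥⋀∥²≡ {n} {suc m} V norms V⊥ = begin
    ∥ ⋀ V ∥²                                  ≡⟨ ℤ.+-identityʳ _ ⟨
    ∥ ⋀ V ∥² + 0ℤ                             ≡⟨ cong (_+_ ∥ ⋀ V ∥²) (trans (cong ∥_∥² u⌟x≡0) (⟪⟫-zeroˡ {n} 0Λ)) ⟨
    ∥ ⋀ V ∥² + ∥ head V ⌟ ⋀ (tail V) ∥²       ≡⟨ head-pythagoras V norms ⟩
    + d * ∥ ⋀ (tail V) ∥²                     ≡⟨ cong (+ d *_) (orthogonal⇒∥⋀∥²≡ (tail V) (norms ∘ suc) (V⊥ ∘ ℕ.s≤s)) ⟩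
    + d * + (d ℕ.^ m)                         ≡⟨ ℤ.pos-* d (d ℕ.^ m) ⟨
    + (d ℕ.^ suc m)                           ∎
    where
    open ≡-Reasoning
    u⌟x≡0 = orthogonal⇒⌟≡0 (head V) (tail V) (λ j → V⊥ (ℕ.s≤s ℕ.z≤n))

  module _ .{{_ : NonZero d}} where

    -- Converse of `orthogonal⇒⌟≡0` for an orthogonal family of nonzero vectors. First `v` is shown
    -- orthogonal to the leading vector `u`; then `v` is shown to contract the remaining product `x`
    -- to zero as well, so that the argument repeats on the tail.
    ⌟≡0⇒orthogonal : ∀ v (V : Vector (Vector ℤ n) m) → IsEquinormal V → PairwiseOrthogonal V →
      v ⌟ ⋀ V ≡ 0Λ → ∀ j → dot v (V j) ≡ 0ℤ
    ⌟≡0⇒orthogonal {n} {suc m} v V norms V⊥ v⌟u∧x≡0 =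
      λ { zero → v⊥u ; (suc j) → ⌟≡0⇒orthogonal v (tail V) (norms ∘ suc) (V⊥ ∘ ℕ.s≤s) v⌟x≡0 j }
      where
      u = head V
      x = ⋀ (tail V)

      u⌟x≡0 : u ⌟ x ≡ 0Λ
      u⌟x≡0 = orthogonal⇒⌟≡0 u (tail V) (λ j → V⊥ (ℕ.s≤s ℕ.z≤n))

      u∧v⌟x : u ∧ v ⌟ x ≡ dot v u · x ⊕ 0ℤ · x
      u∧v⌟x = begin
        u ∧ v ⌟ x                       ≡⟨ ⊕-identityˡ _ ⟨
        1ℤ · 0Λ ⊕ 1ℤ · u ∧ v ⌟ x        ≡⟨ cong (λ y → 1ℤ · y ⊕ 1ℤ · u ∧ v ⌟ x) v⌟u∧x≡0 ⟨
        1ℤ · v ⌟ u ∧ x ⊕ 1ℤ · u ∧ v ⌟ x ≡⟨ ⌟-∧ v u x ⟩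
        dot v u · x ⊕ 0ℤ · x            ∎
        where open ≡-Reasoning

      -- Pairing the previous identity with `x` moves `u` to the other side as a contraction, which
      -- kills `x`.
      v⊥u*∥x∥² : dot v u * ∥ x ∥² ≡ 0ℤ
      v⊥u*∥x∥² = begin
        dot v u * ∥ x ∥²                 ≡⟨ add-zero (dot v u) ∥ x ∥² ⟩
        dot v u * ∥ x ∥² + 0ℤ * ∥ x ∥²   ≡⟨ ⟪⟫-linearˡ (dot v u) 0ℤ x x x ⟨
        ⟪ dot v u · x ⊕ 0ℤ · x , x ⟫     ≡⟨ cong ⟪_, x ⟫ u∧v⌟x ⟨
        ⟪ u ∧ v ⌟ x , x ⟫                ≡⟨ ∧-⌟-adjoint u (v ⌟ x) x ⟩
        ⟪ v ⌟ x , u ⌟ x ⟫                ≡⟨ cong ⟪ v ⌟ x ,_⟫ u⌟x≡0 ⟩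
        ⟪ v ⌟ x , 0Λ ⟫                   ≡⟨ ⟪⟫-zeroʳ (v ⌟ x) ⟩
        0ℤ                               ∎
        where
        open ≡-Reasoning
        add-zero : ∀ k a → k * a ≡ k * a + 0ℤ * a
        add-zero = solve-∀

      v⊥u : dot v u ≡ 0ℤ
      v⊥u = [ id , (λ ∥x∥²≡0 → contradiction (trans (sym ∥x∥²) ∥x∥²≡0) d^m≢0) ]′
              (ℤ.i*j≡0⇒i≡0∨j≡0 (dot v u) v⊥u*∥x∥²)
        where
        ∥x∥² : ∥ x ∥² ≡ + (d ℕ.^ m)
        ∥x∥² = orthogonal⇒∥⋀∥²≡ (tail V) (norms ∘ suc) (V⊥ ∘ ℕ.s≤s)
        d^m≢0 : + (d ℕ.^ m) ≢ 0ℤ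
        d^m≢0 eq = ℕ.≢-nonZero⁻¹ (d ℕ.^ m) {{ℕ.m^n≢0 d m}} (ℤ.+-injective eq)

      u∧v⌟x≡0 : u ∧ v ⌟ x ≡ 0Λ
      u∧v⌟x≡0 = trans u∧v⌟x (trans (cong (λ k → k · x ⊕ 0ℤ · x) v⊥u) (⊕-null x x))

      -- Contractions anticommute, and `u` already contracts `x` to zero.
      u⌟v⌟x≡0 : u ⌟ v ⌟ x ≡ 0Λ
      u⌟v⌟x≡0 rewrite ⌟-⌟ u v x | u⌟x≡0 | ⌟-zero v = ⊕-zero -1ℤ 0ℤ

      -- Wedging and contracting with `u` both annihilate `v ⌟ x`; since `u` has squared norm `d`,
      -- which is nonzero, Pythagoras forces `v ⌟ x` to vanish.
      v⌟x≡0 : v ⌟ x ≡ 0Λ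
      v⌟x≡0 = ∥x∥²≡0⇒x≡0 _ (ℤ.*-cancelˡ-≡ (+ d) _ _ (begin
        + d * ∥ v ⌟ x ∥²                     ≡⟨ cong (_* ∥ v ⌟ x ∥²) (norms zero) ⟨
        dot u u * ∥ v ⌟ x ∥²                 ≡⟨ pythagoras u (v ⌟ x) ⟨
        ∥ u ∧ v ⌟ x ∥² + ∥ u ⌟ v ⌟ x ∥²      ≡⟨ cong₂ (λ y z → ∥ y ∥² + ∥ z ∥²) u∧v⌟x≡0 u⌟v⌟x≡0 ⟩
        ∥ 0Λ {n} ∥² + ∥ 0Λ {n} ∥²            ≡⟨ cong (λ i → i + i) (⟪⟫-zeroˡ {n} 0Λ) ⟩
        0ℤ                                   ≡⟨ *-zeroʳ (+ d) ⟨
        + d * 0ℤ                             ∎))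
        where open ≡-Reasoning

    -- The chain |u ∧ x|² ≤ d |x|² ≤ d · dᵐ has equal ends, so both steps are equalities. The first
    -- gives u ⌟ x = 0; the second, after cancelling `d`, is the hypothesis for the tail.
    ∥⋀∥²≡⇒orthogonal : ∀ (V : Vector (Vector ℤ n) m) → IsEquinormal V →
      ∥ ⋀ V ∥² ≡ + (d ℕ.^ m) → PairwiseOrthogonal V
    ∥⋀∥²≡⇒orthogonal {n} {suc m} V norms eq = orthogonal
      where
      u = head V
      x = ⋀ (tail V)

      ∥u∧x∥² : ∥ u ∧ x ∥² ≡ + d * ∥ x ∥²
      ∥u∧x∥² = ℤ.≤-antisym
        (subst (∥ u ∧ x ∥² ℤ.≤_) (head-pythagoras V norms) (i≤i+j _ (0≤∥x∥² (u ⌟ x))))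
        (begin
          + d * ∥ x ∥²        ≤⟨ ℤ.*-monoˡ-≤-nonNeg (+ d) (∥⋀∥²≤ (tail V) (norms ∘ suc)) ⟩
          + d * + (d ℕ.^ m)   ≡⟨ ℤ.pos-* d (d ℕ.^ m) ⟨
          + (d ℕ.^ suc m)     ≡⟨ eq ⟨
          ∥ u ∧ x ∥²          ∎)
        where open ℤ.≤-Reasoning

      u⌟x≡0 : u ⌟ x ≡ 0Λ
      u⌟x≡0 = ∥x∥²≡0⇒x≡0 _ (i+j≡i⇒j≡0 ∥ u ∧ x ∥² (trans (head-pythagoras V norms) (sym ∥u∧x∥²)))

      ∥x∥² : ∥ x ∥² ≡ + (d ℕ.^ m)
      ∥x∥² = ℤ.*-cancelˡ-≡ (+ d) _ _ (trans (sym ∥u∧x∥²) (trans eq (ℤ.pos-* d (d ℕ.^ m))))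

      tail-orthogonal : PairwiseOrthogonal (tail V)
      tail-orthogonal = ∥⋀∥²≡⇒orthogonal (tail V) (norms ∘ suc) ∥x∥²

      orthogonal : PairwiseOrthogonal V
      orthogonal {zero}  {suc j} _           = ⌟≡0⇒orthogonal u (tail V) (norms ∘ suc) tail-orthogonal u⌟x≡0 j
      orthogonal {suc i} {suc j} (ℕ.s≤s i<j) = tail-orthogonal i<j

-- Minors as coordinates of wedge products

open import Data.Vec.Base using ([]; _∷_)
open import Data.Vec.Relation.Unary.AllPairs using (_∷_)

lookup-removeAt : ∀ {A : Set} (xs : Vec A (suc n)) i j →
  lookup (removeAt xs i) j ≡ lookup xs (punchIn i j)
lookup-removeAt (x ∷ xs)     zero    j       = refl
lookup-removeAt (x ∷ y ∷ xs) (suc i) zero    = refl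
lookup-removeAt (x ∷ y ∷ xs) (suc i) (suc j) = lookup-removeAt (y ∷ xs) i j

removeAt-map : ∀ {A B : Set} (f : A → B) (xs : Vec A (suc n)) i →
  removeAt (Vec.map f xs) i ≡ Vec.map f (removeAt xs i)
removeAt-map f (x ∷ xs)     zero    = refl
removeAt-map f (x ∷ y ∷ xs) (suc i) = cong (f x ∷_) (removeAt-map f (y ∷ xs) i)

det-cong : ∀ {A B : SquareMatrix n} → (∀ i j → A i j ≡ B i j) → det A ≡ det B
det-cong {zero}  A≗B = refl
det-cong {suc n} A≗B = sum-cong-≗ λ j →
  cong₂ (λ a b → (-1ℤ ℤ.^ toℕ j) * a * b) (A≗B zero j) (det-cong λ i k → A≗B (suc i) (punchIn j k))

minor : Vector (Vector ℤ n) m → Vec (Fin n) m → ℤ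
minor V T = det λ i k → V i (lookup T k)

-- Exterior multiplication by `v` in coordinates, as `form-laplace` shows; on minors it is the
-- expansion along a first row `v`.
laplace : Vector ℤ n → (Vec (Fin n) m → ℤ) → Vec (Fin n) (suc m) → ℤ
laplace v f T = sum λ j → (-1ℤ ℤ.^ toℕ j) * v (lookup T j) * f (removeAt T j)

minor-laplace : ∀ (V : Vector (Vector ℤ n) (suc m)) T →
  minor V T ≡ laplace (head V) (minor (tail V)) T
minor-laplace V T = sum-cong-≗ λ j → cong ((-1ℤ ℤ.^ toℕ j) * V zero (lookup T j) *_)
  (det-cong λ i k → cong (V (suc i)) (sym (lookup-removeAt T j k)))

laplace-map-suc : ∀ v (f : Vec (Fin (suc n)) m → ℤ) T →
  laplace v f (Vec.map suc T) ≡ laplace (tail v) (f ∘ Vec.map suc) T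
laplace-map-suc v f T = sum-cong-≗ λ j →
  cong₂ (λ i U → (-1ℤ ℤ.^ toℕ j) * v i * f U) (Vec.lookup-map j suc T) (removeAt-map suc T j)

-- The summand `-1ℤ * 0ℤ` gives the right side the shape required by `form-linear`; it corresponds
-- to `tail v ∧ 0Λ`.
laplace-zero∷[] : ∀ v (f : Vec (Fin (suc n)) 0 → ℤ) →
  laplace v f (zero ∷ []) ≡ head v * f [] + -1ℤ * 0ℤ
laplace-zero∷[] v f = drop-one (v zero) (f [])
  where
  drop-one : ∀ c a → 1ℤ * c * a + 0ℤ ≡ c * a + -1ℤ * 0ℤ
  drop-one = solve-∀

-- Removing the leading `zero` gives the `head v` term. Every other position is shifted by one,
-- which changes its sign: this is the e₀-component of the wedge.
laplace-zero∷ : ∀ v (f : Vec (Fin (suc n)) (suc m) → ℤ) T →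
  laplace v f (zero ∷ Vec.map suc T) ≡
  head v * f (Vec.map suc T) + -1ℤ * laplace (tail v) (λ U → f (zero ∷ Vec.map suc U)) T
laplace-zero∷ v f T@(_ ∷ _) = cong₂ _+_
  (cong (_* f (Vec.map suc T)) (ℤ.*-identityˡ (v zero)))
  (trans (sum-cong-≗ λ j → trans
    (cong₂ (λ i U → (-1ℤ * -1ℤ ℤ.^ toℕ j) * v i * f (zero ∷ U)) (Vec.lookup-map j suc T) (removeAt-map suc T j))
    (reassoc (-1ℤ ℤ.^ toℕ j) _ _))
  (sym (*-distribˡ-sum -1ℤ λ j →
    (-1ℤ ℤ.^ toℕ j) * v (suc (lookup T j)) * f (zero ∷ Vec.map suc (removeAt T j)))))
  where
  reassoc : ∀ s a b → -1ℤ * s * a * b ≡ -1ℤ * (s * a * b)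
  reassoc = solve-∀

-- The m-form whose coefficient at the increasing index vector T is f T.
form : ∀ n m → (Vec (Fin n) m → ℤ) → Λ n
form zero    zero    f = leaf (f [])
form zero    (suc m) f = leaf 0ℤ
form (suc n) zero    f = node 0Λ (form n zero (f ∘ Vec.map suc))
form (suc n) (suc m) f =
  node (form n m λ T → f (zero ∷ Vec.map suc T)) (form n (suc m) (f ∘ Vec.map suc))

form-cong : ∀ n m {f g : Vec (Fin n) m → ℤ} → (∀ T → f T ≡ g T) → form n m f ≡ form n m g
form-cong zero    zero    f≗g = cong leaf (f≗g [])
form-cong zero    (suc m) f≗g = refl
form-cong (suc n) zero    f≗g = cong (node 0Λ) (form-cong n zero (f≗g ∘ Vec.map suc))
form-cong (suc n) (suc m) f≗g =
  cong₂ node (form-cong n m λ T → f≗g (zero ∷ Vec.map suc T)) (form-cong n (suc m) (f≗g ∘ Vec.map suc))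

form-zero : ∀ n m → form n m (λ _ → 0ℤ) ≡ 0Λ
form-zero zero    zero    = refl
form-zero zero    (suc m) = refl
form-zero (suc n) zero    = cong (node 0Λ) (form-zero n zero)
form-zero (suc n) (suc m) = cong₂ node (form-zero n m) (form-zero n (suc m))

form-one : ∀ n → form n zero (λ _ → 1ℤ) ≡ 1Λ
form-one zero    = refl
form-one (suc n) = cong (node 0Λ) (form-one n)

form-linear : ∀ n m p q (f g : Vec (Fin n) m → ℤ) →
  form n m (λ T → p * f T + q * g T) ≡ p · form n m f ⊕ q · form n m g
form-linear zero    zero    p q f g = refl
form-linear zero    (suc m) p q f g = sym (⊕-zero p q)
form-linear (suc n) zero    p q f g =
  cong₂ node (sym (⊕-zero p q)) (form-linear n zero p q (f ∘ Vec.map suc) (g ∘ Vec.map suc))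
form-linear (suc n) (suc m) p q f g = cong₂ node
  (form-linear n m p q (λ T → f (zero ∷ Vec.map suc T)) (λ T → g (zero ∷ Vec.map suc T)))
  (form-linear n (suc m) p q (f ∘ Vec.map suc) (g ∘ Vec.map suc))

-- The two components of `node` collect the index vectors with and without the index 0. On each kind
-- the expansion obeys the recursion that defines `_∧_`.
form-laplace : ∀ n m v (f : Vec (Fin n) m → ℤ) → form n (suc m) (laplace v f) ≡ v ∧ form n m f
form-laplace zero    zero    v f = refl
form-laplace zero    (suc m) v f = refl
form-laplace (suc n) zero    v f = cong₂ node
  (begin
    form n 0 (λ T → laplace v f (zero ∷ Vec.map suc T))
      ≡⟨ form-cong n 0 (λ { [] → laplace-zero∷[] v f }) ⟩
    form n 0 (λ T → head v * f (Vec.map suc T) + -1ℤ * 0ℤ)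
      ≡⟨ form-linear n 0 (head v) -1ℤ (f ∘ Vec.map suc) (λ _ → 0ℤ) ⟩
    head v · form n 0 (f ∘ Vec.map suc) ⊕ -1ℤ · form n 0 (λ _ → 0ℤ)
      ≡⟨ cong (_·_⊕_·_ (head v) _ -1ℤ) (trans (form-zero n 0) (sym (∧-zero (tail v)))) ⟩
    head v · form n 0 (f ∘ Vec.map suc) ⊕ -1ℤ · tail v ∧ 0Λ ∎)
  (trans (form-cong n 1 (laplace-map-suc v f)) (form-laplace n 0 (tail v) (f ∘ Vec.map suc)))
  where open ≡-Reasoning
form-laplace (suc n) (suc m) v f = cong₂ node
  (begin
    form n (suc m) (λ T → laplace v f (zero ∷ Vec.map suc T))
      ≡⟨ form-cong n (suc m) (laplace-zero∷ v f) ⟩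
    form n (suc m) (λ T → head v * f (Vec.map suc T) + -1ℤ * laplace (tail v) f₀ T)
      ≡⟨ form-linear n (suc m) (head v) -1ℤ (f ∘ Vec.map suc) (laplace (tail v) f₀) ⟩
    head v · form n (suc m) (f ∘ Vec.map suc) ⊕ -1ℤ · form n (suc m) (laplace (tail v) f₀)
      ≡⟨ cong (_·_⊕_·_ (head v) _ -1ℤ) (form-laplace n m (tail v) f₀) ⟩
    head v · form n (suc m) (f ∘ Vec.map suc) ⊕ -1ℤ · tail v ∧ form n m f₀ ∎)
  (trans (form-cong n (suc (suc m)) (laplace-map-suc v f))
         (form-laplace n (suc m) (tail v) (f ∘ Vec.map suc)))
  where
  open ≡-Reasoning
  f₀ = λ T → f (zero ∷ Vec.map suc T)

form-minor : ∀ (V : Vector (Vector ℤ n) m) → form n m (minor V) ≡ ⋀ V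
form-minor {n} {zero}  V = form-one n
form-minor {n} {suc m} V = begin
  form n (suc m) (minor V)                            ≡⟨ form-cong n (suc m) (minor-laplace V) ⟩
  form n (suc m) (laplace (head V) (minor (tail V)))  ≡⟨ form-laplace n m (head V) (minor (tail V)) ⟩
  head V ∧ form n m (minor (tail V))                  ≡⟨ cong (head V ∧_) (form-minor (tail V)) ⟩
  ⋀ V                                                 ∎
  where open ≡-Reasoning

-- Sums over lists and the Cauchy-Binet formula

∑ : ∀ {A : Set} → (A → ℤ) → List A → ℤ
∑ f xs = foldr _+_ 0ℤ (List.map f xs)

∑-++ : ∀ {A : Set} (f : A → ℤ) xs ys → ∑ f (xs ++ ys) ≡ ∑ f xs + ∑ f ys
∑-++ f []       ys = sym (ℤ.+-identityˡ _)
∑-++ f (x ∷ xs) ys = trans (cong (_+_ (f x)) (∑-++ f xs ys)) (sym (ℤ.+-assoc (f x) _ _))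

∑-map : ∀ {A B : Set} (f : B → ℤ) (g : A → B) xs → ∑ f (List.map g xs) ≡ ∑ (f ∘ g) xs
∑-map f g xs = cong (foldr _+_ 0ℤ) (sym (List.map-∘ xs))

∑-cong : ∀ {A : Set} {f g : A → ℤ} → (∀ x → f x ≡ g x) → ∀ xs → ∑ f xs ≡ ∑ g xs
∑-cong f≗g xs = cong (foldr _+_ 0ℤ) (List.map-cong f≗g xs)

∑-cartesianProductWith : ∀ {A B C : Set} (g : C → ℤ) (f : A → B → C) xs ys →
  ∑ g (cartesianProductWith f xs ys) ≡ ∑ (λ x → ∑ (g ∘ f x) ys) xs
∑-cartesianProductWith g f []       ys = refl
∑-cartesianProductWith g f (x ∷ xs) ys = trans (∑-++ g (List.map (f x) ys) _)
  (cong₂ _+_ (∑-map g (f x) ys) (∑-cartesianProductWith g f xs ys))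

-- `form` and `combinations` both branch on whether the index 0 is chosen, so the coordinates of the
-- form that can be nonzero are the values of `f` on the listed vectors.
∥form∥² : ∀ n m (f : Vec (Fin n) m → ℤ) → ∥ form n m f ∥² ≡ ∑ (λ T → f T ℤ.^ 2) (combinations n m)
∥form∥² zero    zero    f = square (f [])
  where
  square : ∀ i → i * i ≡ i * (i * 1ℤ) + 0ℤ
  square = solve-∀
∥form∥² zero    (suc m) f = refl
∥form∥² (suc n) zero    f =
  trans (cong₂ _+_ (⟪⟫-zeroˡ {n} 0Λ) (∥form∥² n zero (f ∘ Vec.map suc))) (ℤ.+-identityˡ _)
∥form∥² (suc n) (suc m) f = begin
  ∥ form n m (λ T → f (zero ∷ Vec.map suc T)) ∥² + ∥ form n (suc m) (f ∘ Vec.map suc) ∥²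
    ≡⟨ cong₂ _+_ (∥form∥² n m _) (∥form∥² n (suc m) _) ⟩
  ∑ (λ T → f (zero ∷ Vec.map suc T) ℤ.^ 2) (combinations n m) +
  ∑ (λ T → f (Vec.map suc T) ℤ.^ 2) (combinations n (suc m))
    ≡⟨ cong₂ _+_ (∑-map _ _ (combinations n m)) (∑-map _ _ (combinations n (suc m))) ⟨
  ∑ f² (List.map (λ T → zero ∷ Vec.map suc T) (combinations n m)) +
  ∑ f² (List.map (Vec.map suc) (combinations n (suc m)))
    ≡⟨ ∑-++ f² (List.map _ (combinations n m)) _ ⟨
  ∑ f² (combinations (suc n) (suc m)) ∎
  where
  open ≡-Reasoning
  f² = λ T → f T ℤ.^ 2

-- The squared norm of the wedge product takes the place of the Gram determinant.
cauchy-binet : ∀ (V : Vector (Vector ℤ n) m) →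
  ∑ (λ T → minor V T ℤ.^ 2) (combinations n m) ≡ ∥ ⋀ V ∥²
cauchy-binet V = trans (sym (∥form∥² _ _ (minor V))) (cong ∥_∥² (form-minor V))

rows : SquareMatrix n → Vec (Fin n) m → Vector (Vector ℤ n) m
rows A S i = A (lookup S i)

∑-det² : ∀ m (A : SquareMatrix n) →
  ∑ det² (submatrices m A) ≡ ∑ (λ S → ∥ ⋀ (rows A S) ∥²) (combinations n m)
∑-det² {n} m A = trans
  (∑-cartesianProductWith det² (submatrix A) (combinations n m) (combinations n m))
  (∑-cong (λ S → cauchy-binet (rows A S)) (combinations n m))

-- Averaging over the choices of rows

+-mono-≤-equality : ∀ {a b c d} → a ℤ.≤ b → c ℤ.≤ d → a + c ≡ b + d → a ≡ b × c ≡ d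
+-mono-≤-equality {a} {b} {c} {d} a≤b c≤d a+c≡b+d with a ℤ.≟ b
... | yes refl = refl , ∙-cancelˡ a c d a+c≡b+d
... | no  a≢b  = contradiction a+c≡b+d (ℤ.<⇒≢ (ℤ.+-mono-<-≤ (ℤ.≤∧≢⇒< a≤b a≢b) c≤d))

private
  suc-* : ∀ k c → c + + k * c ≡ + suc k * c
  suc-* k c = sym (ℤ.suc-* (+ k) c)

∑-≤ : ∀ {A : Set} {f : A → ℤ} {c} → (∀ x → f x ℤ.≤ c) → ∀ xs → ∑ f xs ℤ.≤ + length xs * c
∑-≤ {c = c} f≤c []       = ℤ.≤-refl
∑-≤ {c = c} f≤c (x ∷ xs) =
  subst (_ ℤ.≤_) (suc-* (length xs) c) (ℤ.+-mono-≤ (f≤c x) (∑-≤ f≤c xs))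

∑-≡⇒ : ∀ {A : Set} {f : A → ℤ} {c} → (∀ x → f x ℤ.≤ c) → ∀ xs →
  ∑ f xs ≡ + length xs * c → ∀ {x} → x ∈ xs → f x ≡ c
∑-≡⇒ {c = c} f≤c (x ∷ xs) eq
  with fx≡c , ∑≡ ← +-mono-≤-equality (f≤c x) (∑-≤ f≤c xs) (trans eq (sym (suc-* (length xs) c)))
  = λ { (here refl) → fx≡c ; (there x∈xs) → ∑-≡⇒ f≤c xs ∑≡ x∈xs }

∑-const : ∀ {A : Set} {f : A → ℤ} {c} xs → (∀ {x} → x ∈ xs → f x ≡ c) → ∑ f xs ≡ + length xs * c
∑-const []       f≡c = refl
∑-const (x ∷ xs) f≡c =
  trans (cong₂ _+_ (f≡c (here refl)) (∑-const xs (f≡c ∘ there))) (suc-* (length xs) _)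

-- Row choices containing given rows

∣p∪q∣≤∣p∣+∣q∣ : ∀ (p q : Subset n) → ∣ p ∪ q ∣ ≤ ∣ p ∣ ℕ.+ ∣ q ∣
∣p∪q∣≤∣p∣+∣q∣ []            []            = z≤n
∣p∪q∣≤∣p∣+∣q∣ (outside ∷ p) (outside ∷ q) = ∣p∪q∣≤∣p∣+∣q∣ p q
∣p∪q∣≤∣p∣+∣q∣ (outside ∷ p) (inside ∷ q)  =
  subst (suc ∣ p ∪ q ∣ ≤_) (sym (ℕ.+-suc ∣ p ∣ ∣ q ∣)) (s≤s (∣p∪q∣≤∣p∣+∣q∣ p q))
∣p∪q∣≤∣p∣+∣q∣ (inside ∷ p)  (outside ∷ q) = s≤s (∣p∪q∣≤∣p∣+∣q∣ p q)
∣p∪q∣≤∣p∣+∣q∣ (inside ∷ p)  (inside ∷ q)  =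
  s≤s (ℕ.≤-trans (∣p∪q∣≤∣p∣+∣q∣ p q) (ℕ.+-monoʳ-≤ ∣ p ∣ (ℕ.n≤1+n ∣ q ∣)))

∣⁅x⁆∪⁅y⁆∣≤2 : ∀ (x y : Fin n) → ∣ ⁅ x ⁆ ∪ ⁅ y ⁆ ∣ ≤ 2
∣⁅x⁆∪⁅y⁆∣≤2 x y = subst (∣ ⁅ x ⁆ ∪ ⁅ y ⁆ ∣ ≤_) (cong₂ ℕ._+_ (∣⁅x⁆∣≡1 x) (∣⁅x⁆∣≡1 y))
  (∣p∪q∣≤∣p∣+∣q∣ ⁅ x ⁆ ⁅ y ⁆)

Covers : Vec (Fin n) m → Subset n → Set
Covers S p = ∀ {x} → x Subset.∈ p → ∃ λ i → lookup S i ≡ x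

private
  covers-zero∷ : ∀ (S : Vec (Fin n) m) {p s} → Covers S p → Covers (zero ∷ Vec.map suc S) (s ∷ p)
  covers-zero∷ S S⊇p here        = zero , refl
  covers-zero∷ S S⊇p (there x∈p) with i , refl ← S⊇p x∈p = suc i , Vec.lookup-map i suc S

  covers-map-suc : ∀ (S : Vec (Fin n) m) {p} → Covers S p → Covers (Vec.map suc S) (outside ∷ p)
  covers-map-suc S S⊇p (there x∈p) with i , refl ← S⊇p x∈p = i , Vec.lookup-map i suc S

-- Greedy extension of `p` to `m` elements: an index outside `p` is skipped as long as enough
-- indices remain.
covering-combination : ∀ n m (p : Subset n) → ∣ p ∣ ≤ m → m ≤ n →
  ∃ λ S → S ∈ combinations n m × Covers S p
covering-combination zero    zero    []            _         _         = [] , here refl , λ ()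
covering-combination (suc n) zero    (outside ∷ p) ∣p∣≤0     _
  with [] , _ , S⊇p ← covering-combination n 0 p ∣p∣≤0 z≤n
  = [] , here refl , covers-map-suc [] S⊇p
covering-combination (suc n) (suc m) (inside ∷ p)  (s≤s ∣p∣≤m) (s≤s m≤n)
  with S , S∈ , S⊇p ← covering-combination n m p ∣p∣≤m m≤n
  = zero ∷ Vec.map suc S , ∈-++⁺ˡ (∈-map⁺ _ S∈) , covers-zero∷ S S⊇p
covering-combination (suc n) (suc m) (outside ∷ p) ∣p∣≤1+m (s≤s m≤n) with ℕ.m≤n⇒m<n∨m≡n m≤n
... | inj₁ m<n
  with S , S∈ , S⊇p ← covering-combination n (suc m) p ∣p∣≤1+m m<n
  = Vec.map suc S , ∈-++⁺ʳ (List.map _ (combinations n m)) (∈-map⁺ _ S∈) , covers-map-suc S S⊇p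
-- All indices are needed here, so 0 is taken although it lies outside `p`; the size bound for the
-- rest holds for every subset.
... | inj₂ refl
  with S , S∈ , S⊇p ← covering-combination n n p (∣p∣≤n p) m≤n
  = zero ∷ Vec.map suc S , ∈-++⁺ˡ (∈-map⁺ _ S∈) , covers-zero∷ S S⊇p

increasing-lookup : ∀ {S : Vec (Fin n) m} → Increasing S → ∀ {p q} → p Fin.< q → lookup S p Fin.< lookup S q
increasing-lookup (x< ∷ S↑) {zero}  {suc q} _         = VecAll.lookup⁺ x< q
increasing-lookup (x< ∷ S↑) {suc p} {suc q} (s≤s p<q) = increasing-lookup S↑ p<q

-- Sign matrices and Hadamard matrices

dot-comm : ∀ (u v : Vector ℤ n) → dot u v ≡ dot v u
dot-comm u v = sum-cong-≗ λ k → *-comm (u k) (v k)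

dot-sign : ∀ (v : Vector ℤ n) → (∀ k → v k ≡ 1ℤ ⊎ v k ≡ -1ℤ) → dot v v ≡ + n
dot-sign {zero}  v v±1 = refl
dot-sign {suc n} v v±1 = cong₂ _+_ ([ square , square ]′ (v±1 zero)) (dot-sign (tail v) (v±1 ∘ suc))
  where
  square : ∀ {i} → v zero ≡ i → v zero * v zero ≡ i * i
  square eq = cong (λ i → i * i) eq

OrthogonalRows : SquareMatrix n → Set
OrthogonalRows A = ∀ {i j} → i ≢ j → dot (A i) (A j) ≡ 0ℤ

-- The entries of `A *ᴹ (A ᵀ)` are the dot products of rows, and signs make the diagonal equal to
-- `n`; only the off-diagonal entries impose a condition.
isHadamard⇔ : ∀ {A : SquareMatrix n} → IsSignMatrix A → IsHadamard A ⇔ OrthogonalRows A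
isHadamard⇔ {n} {A} A±1 = mk⇔ (to ∘ proj₂) (λ A⊥ → A±1 , from A⊥)
  where
  to : (∀ i j → (A *ᴹ (A ᵀ)) i j ≡ + n * identity i j) → OrthogonalRows A
  to AAᵀ≡nI {i} {j} i≢j with i Fin.≟ j | AAᵀ≡nI i j
  ... | yes i≡j | _  = contradiction i≡j i≢j
  ... | no  _   | eq = trans eq (*-zeroʳ (+ n))
  from : OrthogonalRows A → ∀ i j → (A *ᴹ (A ᵀ)) i j ≡ + n * identity i j
  from A⊥ i j with i Fin.≟ j
  ... | yes refl = trans (dot-sign (A i) (A±1 i)) (sym (ℤ.*-identityʳ (+ n)))
  ... | no  i≢j  = trans (A⊥ i≢j) (sym (*-zeroʳ (+ n)))

-- Comparing fractions by cross multiplication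

/-mono-≤ : ∀ a b c d .{{_ : NonZero b}} .{{_ : NonZero d}} →
  a * + d ℤ.≤ c * + b → a / b ℚ.≤ c / d
/-mono-≤ a (suc b) c (suc d) ad≤cb = ℚ.toℚᵘ-cancel-≤
  (ℚᵘ.≤-respˡ-≃ (ℚᵘ.≃-sym (ℚ.toℚᵘ-fromℚᵘ (ℚᵘ.mkℚᵘ a b)))
  (ℚᵘ.≤-respʳ-≃ (ℚᵘ.≃-sym (ℚ.toℚᵘ-fromℚᵘ (ℚᵘ.mkℚᵘ c d))) (ℚᵘ.*≤* ad≤cb)))

/-≡⇔ : ∀ a b c d .{{_ : NonZero b}} .{{_ : NonZero d}} →
  a / b ≡ c / d ⇔ a * + d ≡ c * + b
/-≡⇔ a (suc b) c (suc d) = mk⇔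
  (λ eq → ℚᵘ.drop-*≡* (ℚ.fromℚᵘ-injective {ℚᵘ.mkℚᵘ a b} {ℚᵘ.mkℚᵘ c d} eq))
  (λ eq → ℚ.fromℚᵘ-cong {ℚᵘ.mkℚᵘ a b} {ℚᵘ.mkℚᵘ c d} (ℚᵘ.*≡* eq))

-- The sum of all squared minors

module SquaredMinors {n} (m : ℕ) (A : SquareMatrix n) (A±1 : IsSignMatrix A) where

  open Hadamard n

  total : ℤ
  total = ∑ det² (submatrices m A)

  private
    row-norms : ∀ (S : Vec (Fin n) m) → IsEquinormal (rows A S)
    row-norms S i = dot-sign (A (lookup S i)) (A±1 (lookup S i))

    bounded : ∀ S → ∥ ⋀ (rows A S) ∥² ℤ.≤ + (n ^ m)
    bounded S = ∥⋀∥²≤ (rows A S) (row-norms S)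

    +length≡ : + length (combinations n m) * + (n ^ m) ≡ + (n C m) * + (n ^ m)
    +length≡ = cong (λ k → + k * + (n ^ m)) (length-combinations n m)

  total≤ : total ℤ.≤ + (n C m) * + (n ^ m)
  total≤ = subst₂ ℤ._≤_ (sym (∑-det² m A)) +length≡ (∑-≤ bounded (combinations n m))

  orthogonal⇒total≡ : OrthogonalRows A → total ≡ + (n C m) * + (n ^ m)
  orthogonal⇒total≡ A⊥ = trans (∑-det² m A) (trans (∑-const (combinations n m) attained) +length≡)
    where
    attained : ∀ {S} → S ∈ combinations n m → ∥ ⋀ (rows A S) ∥² ≡ + (n ^ m)
    attained {S} S∈ = orthogonal⇒∥⋀∥²≡ (rows A S) (row-norms S)
      λ p<q → A⊥ (Fin.<⇒≢ (increasing-lookup (∈-combinations⁻ S∈) p<q))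

  private
    total≡⇒rows-orthogonal : .{{_ : NonZero n}} → total ≡ + (n C m) * + (n ^ m) →
      ∀ {S} → S ∈ combinations n m → PairwiseOrthogonal (rows A S)
    total≡⇒rows-orthogonal total≡ {S} S∈ = ∥⋀∥²≡⇒orthogonal (rows A S) (row-norms S)
      (∑-≡⇒ bounded (combinations n m) (trans (sym (∑-det² m A)) (trans total≡ (sym +length≡))) S∈)

  total≡⇒orthogonal : .{{_ : NonZero n}} → m ≤ n → 1 < m →
    total ≡ + (n C m) * + (n ^ m) → OrthogonalRows A
  total≡⇒orthogonal m≤n 1<m total≡ {i} {j} i≢j
    -- Since 2 ≤ m, some choice of `m` rows contains both `i` and `j`.
    with S , S∈ , S⊇ ← covering-combination n m (⁅ i ⁆ ∪ ⁅ j ⁆) (ℕ.≤-trans (∣⁅x⁆∪⁅y⁆∣≤2 i j) 1<m) m≤n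
    with p , refl ← S⊇ (x∈p∪q⁺ (inj₁ (x∈⁅x⁆ i)))
    with q , refl ← S⊇ (x∈p∪q⁺ (inj₂ (x∈⁅x⁆ j)))
    with Fin.<-cmp p q
  ... | tri< p<q _ _  = total≡⇒rows-orthogonal total≡ S∈ p<q
  ... | tri≈ _ refl _ = contradiction refl i≢j
  -- Orthogonality is recorded only for increasing positions; symmetry of `dot` covers this order.
  ... | tri> _ _ q<p  = trans (dot-comm (A (lookup S p)) (A (lookup S q))) (total≡⇒rows-orthogonal total≡ S∈ q<p)

-- From the sum to the mean

theorem1 : (n m : ℕ) (m≤n : m ≤ n) → 1 < m →
    (A : SquareMatrix n) → IsSignMatrix A →
    let bound = ((+ (n ^ m)) / (n C m)) {{nCm-nonZero m≤n}} in
    (meanDet² m≤n A ℚ.≤ bound) ×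
    (meanDet² m≤n A ≡ bound ⇔ IsHadamard A)
theorem1 n m m≤n 1<m A A±1 =
  /-mono-≤ total L (+ (n ^ m)) N
    (subst (total * + N ℤ.≤_) cross (ℤ.*-monoʳ-≤-nonNeg (+ N) total≤)) ,
  mk⇔
    (λ mean≡ → H.from (total≡⇒orthogonal m≤n 1<m
      -- Equality of the fractions reads total · N = nᵐ · L, and `cross` rewrites the right side as
      -- a multiple of the positive number `N`.
      (ℤ.*-cancelʳ-≡ total _ (+ N) (trans (Mean.to mean≡) (sym cross)))))
    (λ hadamard → Mean.from (trans (cong (_* + N) (orthogonal⇒total≡ (H.to hadamard))) cross))
  where
  open SquaredMinors m A A±1
  N = n C m
  L = length (List.map det² (submatrices m A))

  instance
    n≢0 : NonZero n
    n≢0 = ℕ.>-nonZero (ℕ.<-≤-trans (ℕ.<-trans ℕ.z<s 1<m) m≤n)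
    N≢0 : NonZero N
    N≢0 = nCm-nonZero m≤n
    L≢0 : NonZero L
    L≢0 = length-det²-nonZero m≤n A

  module H = Equivalence (isHadamard⇔ A±1)
  module Mean = Equivalence (/-≡⇔ total L (+ (n ^ m)) N)

  -- There are L = N² submatrices, so the bound N nᵐ on the sum becomes nᵐ / N for the mean.
  cross : + N * + (n ^ m) * + N ≡ + (n ^ m) * + L
  cross = begin
    + N * + (n ^ m) * + N     ≡⟨ swap (+ N) (+ (n ^ m)) ⟩
    + (n ^ m) * (+ N * + N)   ≡⟨ cong (+ (n ^ m) *_) (ℤ.pos-* N N) ⟨
    + (n ^ m) * + (N ℕ.* N)   ≡⟨ cong (λ k → + (n ^ m) * + k) L≡N*N ⟨
    + (n ^ m) * + L           ∎
    where
    open ≡-Reasoning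
    L≡N*N : L ≡ N ℕ.* N
    L≡N*N = trans (List.length-map det² (submatrices m A)) (length-submatrices m A)
    swap : ∀ a b → a * b * a ≡ b * (a * a)
    swap = solve-∀
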